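{- Let $k,n$ be positive integers with $n\ge \frac{(k+4)(k-1)}{2}+1$. Then there exists a ucycle of the set of all onto functions $f:[n]\to[k]$ for which the preimage cardinality function is strictly increasing, i.e. $|f^{ -1}(\{1\})|<|f^{ -1}(\{2\})|<\cdots<|f^{ -1}(\{k\})|$.
   Context: $[m]=\{1,2,\dots,m\}$. A function $f:[n]\to[k]$ is identified with the string $f(1)f(2)\cdots f(n)$ of length $n$ over the alphabet $[k]$. A ucycle (universal cycle) of a finite nonempty set $\mathcal F$ of strings of length $n$ over $[k]$ is a cyclic sequence $a_1a_2\cdots a_N$ of elements of $[k]$, with $N=|\mathcal F|$ and indices taken modulo $N$, such that the $N$ windows $a_ia_{i+1}\cdots a_{i+n-1}$ ($1\le i\le N$) are exactly the elements of $\mathcal F$, each occurring exactly once. -}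

module Defs where

open import Data.Fin.Base using (Fin; toℕ) renaming (_<_ to _<ᶠ_)
open import Data.Fin.Properties using (_≟_)
open import Data.Fin.Subset using (Subset; ∣_∣)
open import Data.Nat.Base using (ℕ; _+_; _<_; NonZero)
open import Data.Nat.DivMod using (_mod_)
open import Data.Product using (_×_; ∃!)
open import Data.Vec.Base using (Vec; lookup; tabulate)
open import Function.Definitions using (Surjective)
open import Level using (Level; 0ℓ)
open import Relation.Binary.Core using (_Preserves_⟶_)
open import Relation.Binary.PropositionalEquality.Core using (_≡_)
open import Relation.Nullary.Decidable.Core using (does)
open import Relation.Unary using (Pred; _∈_)

private
  variable
    ℓ : Level
    k n : ℕ

-- The letters 1, …, k and the positions 1, …, n are represented by
-- Fin k and Fin n, hence shifted down by one; the order is unchanged.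
String : ℕ → ℕ → Set
String k n = Vec (Fin k) n

window : ∀ {N} .{{_ : NonZero N}} → String k N → (n : ℕ) → Fin N → String k n
window {N = N} a n i = tabulate λ j → lookup a ((toℕ i + toℕ j) mod N)

-- The two fields together say that window is a bijection from Fin N onto F,
-- so the condition N = |F| (and that F is finite and nonempty) is implied.
-- The length n of the windows may exceed N.
record IsUcycle (F : Pred (String k n) ℓ)
                {N : ℕ} .{{_ : NonZero N}} (a : String k N) : Set ℓ where
  field
    window∈F    : ∀ i → window a n i ∈ F
    exactlyOnce : ∀ {s} → s ∈ F → ∃! _≡_ λ i → window a n i ≡ s

record Ucycle (F : Pred (String k n) ℓ) : Set ℓ where
  field
    N              : ℕ
    {{N-nonZero}}  : NonZero N
    sequence       : String k N
    isUcycle       : IsUcycle F sequence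

preimage : (Fin n → Fin k) → Fin k → Subset n
preimage f c = tabulate λ i → does (f i ≟ c)

preimageCardinality : (Fin n → Fin k) → Fin k → ℕ
preimageCardinality f c = ∣ preimage f c ∣

OntoIncreasing : Pred (Fin n → Fin k) 0ℓ
OntoIncreasing f =
  Surjective _≡_ _≡_ f × preimageCardinality f Preserves _<ᶠ_ ⟶ _<_

-- A function is identified with the string of its values.
OntoIncreasingStrings : (k n : ℕ) → Pred (String k n) 0ℓ
OntoIncreasingStrings k n s = OntoIncreasing (lookup s)

{-# OPTIONS --safe #-}
module Submission where

-- A bijection π of the words that preserves the family F and satisfies
-- π (x v) = v y makes every orbit a cyclic sequence whose windows are that orbit.
-- Start from the rotation; whenever two members x v and x′ v of F lie in different
-- orbits, composing π with their transposition merges the two orbits.  In the end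
-- every orbit is closed under rotation and under changing one letter inside F, so a
-- ucycle exists as soon as these two moves connect F.
--
-- Membership in F depends only on the letter counts, which are strictly increasing
-- and positive.  Changing surplus letters into the top letter leads to the counts
-- 1, 2, …, k - 1, L, and rotation then brings the unique smallest letter to the
-- front.  The bound on n says L ≥ 2 k - 1: enough to raise each of the other letters
-- by one in turn, which makes room to exchange such a letter with a top letter.
-- These exchanges generate all rearrangements of the remaining positions.

import Algebra.Properties.CommutativeMonoid.Sum as Sum
open import Data.Bool.Base using (true; false; if_then_else_)
open import Data.Fin.Base using (Fin; zero; suc; toℕ; fromℕ; fromℕ<; inject₁; finToFun; funToFin)
open import Data.Fin.Properties using (_≟_; pigeonhole; toℕ<n; toℕ≤pred[n]; toℕ-fromℕ; toℕ-fromℕ<; toℕ-inject; toℕ-inject₁; toℕ-injective; all?; any?; ¬∀⟶∃¬-smallest; finToFun-funToFin)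
import Data.Fin.Subset as Subset
open import Data.Fin.Subset.Properties using (∣p∣≤n; p⊂q⇒∣p∣<∣q∣)
open import Data.List.Base as List using (List; []; _∷_; allFin; cartesianProduct)
open import Data.List.Membership.Propositional using () renaming (_∈_ to _∈ˡ_)
open import Data.List.Membership.Propositional.Properties using (∈-allFin; ∈-cartesianProduct⁺; ∈-map⁺)
open import Data.List.Relation.Unary.Any using (here; there)
open import Data.Nat.Base using (ℕ; zero; suc; pred; NonZero; >-nonZero; _+_; _*_; _∸_; _^_; _≤_; _<_; _≥_; z≤n; s≤s; s≤s⁻¹; z<s)
open import Data.Nat.DivMod using (_/_; _%_; _mod_; m%n<n; m≡m%n+[m/n]*n; m*n/n≡m)
open import Data.Nat.GeneralisedArithmetic using (fold; fold-+)
open import Data.Nat.Properties as ℕ hiding (_≟_; ≡-irrelevant)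
open import Data.Nat.Tactic.RingSolver using (solve-∀)
open import Data.Product using (_×_; _,_; proj₁; proj₂; ∃; ∃!)
open import Data.Sum.Base using (_⊎_; inj₁; inj₂; fromInj₂)
open import Data.Vec.Base using (Vec; []; _∷_; _∷ʳ_; _++_; head; tail; lookup; tabulate; replicate; map; _[_]≔_)
open import Data.Vec.Properties using (≡-dec; ∷ʳ-injective; []=⇒lookup; lookup⇒[]=; lookup∘tabulate; tabulate∘lookup; tabulate-cong; lookup∘update; lookup∘update′; []≔-commutes)
open import Function.Base using (_∘_)
open import Function.Bundles using (mk↣)
open import Function.Definitions using (Injective)
open import Level using (0ℓ)
open import Relation.Binary.Definitions using (DecidableEquality; tri<; tri≈; tri>)
open import Relation.Binary.PropositionalEquality using (_≡_; _≢_; refl; sym; trans; cong; cong₂; subst; subst₂; module ≡-Reasoning)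
open import Relation.Nullary using (¬_; Dec; yes; no; does; contradiction; ¬?)
open import Relation.Nullary.Decidable using (via-injection; map′; dec-true; _×-dec_; _⊎-dec_; _→-dec_)
open import Relation.Unary using (Pred; Decidable; _∈_)
open import Defs

open Sum +-0-commutativeMonoid using (sum; sum-cong-≗; sum-replicate-zero; sum-init-last; ∑-distrib-+)

-- Orbits of permutations of a finite set

least : ∀ {P : ℕ → Set} → (∀ m → Dec (P m)) → ∀ m → P m →
        ∃ λ l → P l × (∀ j → j < l → ¬ P j)
least {P} P? m Pm with P? 0
... | yes P0 = 0 , P0 , λ _ ()
least {P} P? zero    Pm | no ¬P0 = contradiction Pm ¬P0
least {P} P? (suc m) Pm | no ¬P0 with least (P? ∘ suc) m Pm
... | l , Pl , below = suc l , Pl , λ where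
        zero    _         → ¬P0
        (suc j) (s≤s j<l) → below j j<l

-- Finiteness enters through an injection into `Fin M`: it gives decidable equality and, by the
-- pigeonhole principle, makes every orbit of an injective map a cycle.
module Orbits {A : Set} {M : ℕ} (encode : A → Fin M)
              (encode-injective : Injective _≡_ _≡_ encode) where

  _≟ᴬ_ : DecidableEquality A
  _≟ᴬ_ = via-injection (mk↣ encode-injective) _≟_

  Reach : (A → A) → A → A → Set
  Reach π x y = ∃ λ m → fold x π m ≡ y

  module _ {π : A → A} where

    reach-refl : ∀ {x} → Reach π x x
    reach-refl = 0 , refl

    reach-step : ∀ {x y} → π x ≡ y → Reach π x y
    reach-step eq = 1 , eq

    reach-trans : ∀ {x y z} → Reach π x y → Reach π y z → Reach π x z
    reach-trans {x} (i , refl) (j , eq) = j + i , trans (fold-+ x π j) eq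

    -- `fold` adds new applications on the outside; this splits off the first application instead.
    fold-step : ∀ x m → fold (π x) π m ≡ fold x π (suc m)
    fold-step x zero    = refl
    fold-step x (suc m) = cong π (fold-step x m)

  reach-mono : ∀ {π ρ} → (∀ x → Reach ρ x (π x)) →
               ∀ {x y} → Reach π x y → Reach ρ x y
  reach-mono {π} {ρ} step {x} (m , refl) = go m
    where
    go : ∀ m → Reach ρ x (fold x π m)
    go zero    = reach-refl
    go (suc m) = reach-trans (go m) (step _)

  module Permutation {π : A → A} (π-injective : Injective _≡_ _≡_ π) where

    fold-injective : ∀ m {x y} → fold x π m ≡ fold y π m → x ≡ y
    fold-injective zero    eq = eq
    fold-injective (suc m) eq = fold-injective m (π-injective eq)

    fold-cancel : ∀ x {i j} → i ≤ j → fold x π i ≡ fold x π j →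
                  fold x π (j ∸ i) ≡ x
    fold-cancel x {i} {j} i≤j eq = sym (fold-injective i (begin
      fold x π i                        ≡⟨ eq ⟩
      fold x π j                        ≡⟨ cong (fold x π) (m+[n∸m]≡n i≤j) ⟨
      fold x π (i + (j ∸ i))            ≡⟨ fold-+ x π i ⟩
      fold (fold x π (j ∸ i)) π i       ∎))
      where open ≡-Reasoning

    -- The length is stored minus one, so that it is positive by construction and `%` applies to it
    -- directly.
    record Period (x : A) : Set where
      constructor mkPeriod
      field
        length-1 : ℕ
        returns  : fold x π (suc length-1) ≡ x

    period : ∀ x → Period x
    period x with pigeonhole (n<1+n M) (λ i → encode (fold x π (toℕ i)))
    ... | i , j , i<j , eq = mkPeriod (pred (toℕ j ∸ toℕ i))
            (subst (λ d → fold x π d ≡ x)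
                   (sym (suc-pred (toℕ j ∸ toℕ i) {{>-nonZero (m<n⇒0<n∸m i<j)}}))
                   (fold-cancel x (<⇒≤ i<j) (encode-injective eq)))

    module _ {x} {p} (returns : fold x π (suc p) ≡ x) where

      fold-multiple : ∀ q → fold x π (q * suc p) ≡ x
      fold-multiple zero    = refl
      fold-multiple (suc q) = trans (fold-+ x π (suc p))
        (trans (cong (λ z → fold z π (suc p)) (fold-multiple q)) returns)

      fold-% : ∀ m → fold x π m ≡ fold x π (m % suc p)
      fold-% m = begin
        fold x π m                                         ≡⟨ cong (fold x π) (m≡m%n+[m/n]*n m (suc p)) ⟩
        fold x π (m % suc p + m / suc p * suc p)        ≡⟨ fold-+ x π (m % suc p) ⟩
        fold (fold x π (m / suc p * suc p)) π (m % suc p) ≡⟨ cong (λ z → fold z π (m % suc p)) (fold-multiple (m / suc p)) ⟩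
        fold x π (m % suc p)                               ∎
        where open ≡-Reasoning

      -- Reducing the number of steps modulo the period turns reachability into a finite search;
      -- decidability and symmetry follow from this.
      reach-bounded : ∀ {y} → Reach π x y → ∃ λ (i : Fin (suc p)) → fold x π (toℕ i) ≡ y
      reach-bounded (m , eq) = fromℕ< (m%n<n m (suc p)) ,
        trans (cong (fold x π) (toℕ-fromℕ< (m%n<n m (suc p)))) (trans (sym (fold-% m)) eq)

    reach-sym : ∀ {x y} → Reach π x y → Reach π y x
    reach-sym {x} r with period x
    ... | mkPeriod p returns with reach-bounded returns r
    ...   | i , eq = suc p ∸ toℕ i ,
            trans (cong (λ z → fold z π (suc p ∸ toℕ i)) (sym eq))
            (trans (sym (fold-+ x π (suc p ∸ toℕ i)))
                  (trans (cong (fold x π) (m∸n+n≡m (<⇒≤ (toℕ<n i)))) returns))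

    reach? : ∀ x y → Dec (Reach π x y)
    reach? x y with period x
    ... | mkPeriod p returns =
      map′ (λ (i , eq) → toℕ i , eq) (reach-bounded returns)
           (any? (λ (i : Fin (suc p)) → fold x π (toℕ i) ≟ᴬ y))

    preimageOf : ∀ y → ∃ λ x → π x ≡ y × Reach π y x
    preimageOf y with period y
    ... | mkPeriod p returns = fold y π p , returns , (p , refl)

    -- Two equal iterates would differ by a smaller period, so minimality yields `distinct`. This
    -- becomes the uniqueness of windows.
    record LeastPeriod (x : A) : Set where
      constructor mkLeastPeriod
      field
        length-1 : ℕ
        returns  : fold x π (suc length-1) ≡ x
        distinct : ∀ {i j : Fin (suc length-1)} → fold x π (toℕ i) ≡ fold x π (toℕ j) → i ≡ j

    leastPeriod : ∀ x → LeastPeriod x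
    leastPeriod x with period x
    ... | mkPeriod q returns
        with least (λ m → fold x π (suc m) ≟ᴬ x) q returns
    ...   | p , returns′ , below = mkLeastPeriod p returns′ distinct
      where
      noShorter : ∀ {i j : Fin (suc p)} → toℕ i < toℕ j → fold x π (toℕ i) ≢ fold x π (toℕ j)
      noShorter {i} {j} i<j eq = below (pred d)
        (s≤s⁻¹ (subst (_< suc p) (sym d≡) (≤-<-trans (m∸n≤m (toℕ j) (toℕ i)) (toℕ<n j))))
        (subst (λ e → fold x π e ≡ x) (sym d≡) (fold-cancel x (<⇒≤ i<j) eq))
        where
        d = toℕ j ∸ toℕ i
        d≡ : suc (pred d) ≡ d
        d≡ = suc-pred d {{>-nonZero (m<n⇒0<n∸m i<j)}}

      distinct : ∀ {i j : Fin (suc p)} → fold x π (toℕ i) ≡ fold x π (toℕ j) → i ≡ j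
      distinct {i} {j} eq with <-cmp (toℕ i) (toℕ j)
      ... | tri< i<j _ _ = contradiction eq (noShorter i<j)
      ... | tri≈ _ i≡j _ = toℕ-injective i≡j
      ... | tri> _ _ j<i = contradiction (sym eq) (noShorter j<i)

  swapped : A → A → A → A
  swapped u v w with w ≟ᴬ u | w ≟ᴬ v
  ... | yes _ | _     = v
  ... | no _  | yes _ = u
  ... | no _  | no _  = w

  swapped-left : ∀ u v → swapped u v u ≡ v
  swapped-left u v with u ≟ᴬ u
  ... | yes _  = refl
  ... | no u≢u = contradiction refl u≢u

  swapped-right : ∀ u v → swapped u v v ≡ u
  swapped-right u v with v ≟ᴬ u | v ≟ᴬ v
  ... | yes eq | _      = eq
  ... | no _   | yes _  = refl
  ... | no _   | no v≢v = contradiction refl v≢v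

  swapped-other : ∀ {u v w} → w ≢ u → w ≢ v → swapped u v w ≡ w
  swapped-other {u} {v} {w} w≢u w≢v with w ≟ᴬ u | w ≟ᴬ v
  ... | yes eq | _      = contradiction eq w≢u
  ... | no _   | yes eq = contradiction eq w≢v
  ... | no _   | no _   = refl

  swapped-involutive : ∀ u v w → swapped u v (swapped u v w) ≡ w
  swapped-involutive u v w with w ≟ᴬ u | w ≟ᴬ v
  ... | yes refl | _        = swapped-right w v
  ... | no _     | yes refl = swapped-left u w
  ... | no w≢u   | no w≢v   = swapped-other w≢u w≢v

  swapped-injective : ∀ u v → Injective _≡_ _≡_ (swapped u v)
  swapped-injective u v {x} {y} eq = trans (sym (swapped-involutive u v x))
    (trans (cong (swapped u v) eq) (swapped-involutive u v y))

  -- Packages the case split on `w`, so that a property of the transposition is checked on the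
  -- exchanged pair and on fixed points only.
  swapped-cases : ∀ (P : A → A → Set) {u v} → P u v → P v u → (∀ w → P w w) →
                  ∀ w → P w (swapped u v w)
  swapped-cases P {u} {v} Puv Pvu Pww w with w ≟ᴬ u | w ≟ᴬ v
  ... | yes refl | _        = Puv
  ... | no _     | yes refl = Pvu
  ... | no _     | no _     = Pww w

  -- Following the new permutation from a, one first runs through the old orbit of b
  -- back to b, and then continues with the old orbit of a.
  module Merge {π : A → A} (π-injective : Injective _≡_ _≡_ π)
               {a b : A} (a↛b : ¬ Reach π a b) where

    open Permutation π-injective

    merged : A → A
    merged = π ∘ swapped a b

    merged-other : ∀ {y} → y ≢ a → y ≢ b → merged y ≡ π y
    merged-other y≢a y≢b = cong π (swapped-other y≢a y≢b)

    merged-left : merged a ≡ π b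
    merged-left = cong π (swapped-left a b)

    merged-right : merged b ≡ π a
    merged-right = cong π (swapped-right a b)

    -- By `avoids`, the old path from `y` meets neither `a` nor `b` before it arrives at `c`, and
    -- the two permutations agree on all points passed until then.
    persists : ∀ {c} → (∀ {y} → Reach π y c → y ≢ c → y ≢ a × y ≢ b) →
               ∀ m {y} → fold y π m ≡ c → Reach merged y c
    persists avoids zero    eq = 0 , eq
    persists {c} avoids (suc m) {y} eq with y ≟ᴬ c
    ... | yes refl = reach-refl
    ... | no y≢c   with y≢a , y≢b ← avoids (suc m , eq) y≢c =
      reach-trans (reach-step (merged-other y≢a y≢b))
                  (persists avoids m (trans (fold-step y m) eq))

    left→right : Reach merged a b
    left→right with reach-sym (reach-step {x = b} refl)
    ... | m , eq = reach-trans (reach-step merged-left)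
      (persists (λ y→b y≢b → (λ { refl → a↛b y→b }) , y≢b) m eq)

    right→left : Reach merged b a
    right→left with reach-sym (reach-step {x = a} refl)
    ... | m , eq = reach-trans (reach-step merged-right)
      (persists (λ y→a y≢a → y≢a , λ { refl → a↛b (reach-sym y→a) }) m eq)

    -- At `a` and `b` the old successor is still reached, after a detour through the other orbit.
    -- Hence merging never separates points that were joined before.
    old-step : ∀ x → Reach merged x (π x)
    old-step x with x ≟ᴬ a | x ≟ᴬ b
    ... | yes refl | _        = reach-trans left→right (reach-step merged-right)
    ... | no _     | yes refl = reach-trans right→left (reach-step merged-left)
    ... | no x≢a   | no x≢b   = reach-step (merged-other x≢a x≢b)

    merged-mono : ∀ {x y} → Reach π x y → Reach merged x y
    merged-mono = reach-mono old-step

-- Merging orbits of shifts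

module _ {A : Set} where

  vec-ext : ∀ {n} {u v : Vec A n} → (∀ i → lookup u i ≡ lookup v i) → u ≡ v
  vec-ext {u = u} {v} eq =
    trans (sym (tabulate∘lookup u)) (trans (tabulate-cong eq) (tabulate∘lookup v))

  rotate : ∀ {n} → Vec A (suc n) → Vec A (suc n)
  rotate (x ∷ v) = v ∷ʳ x

  rotate-injective : ∀ {n} → Injective _≡_ _≡_ (rotate {n})
  rotate-injective {x = x ∷ u} {y ∷ v} eq with refl , refl ← ∷ʳ-injective u v eq = refl

  lookup-∷ʳ-inject₁ : ∀ {n} (v : Vec A n) x i → lookup (v ∷ʳ x) (inject₁ i) ≡ lookup v i
  lookup-∷ʳ-inject₁ (y ∷ v) x zero    = refl
  lookup-∷ʳ-inject₁ (y ∷ v) x (suc i) = lookup-∷ʳ-inject₁ v x i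

  lookup-rotate : ∀ {n} (w : Vec A (suc n)) i → lookup (rotate w) (inject₁ i) ≡ lookup w (suc i)
  lookup-rotate (x ∷ v) = lookup-∷ʳ-inject₁ v x

  ∷ʳ-[]≔ : ∀ {n} (v : Vec A n) x i y → (v [ i ]≔ y) ∷ʳ x ≡ (v ∷ʳ x) [ inject₁ i ]≔ y
  ∷ʳ-[]≔ (z ∷ v) x zero    y = refl
  ∷ʳ-[]≔ (z ∷ v) x (suc i) y = cong (z ∷_) (∷ʳ-[]≔ v x i y)

-- The equivalence relation generated by the two moves. Symmetry may be a constructor because
-- reachability along a permutation of a finite set is symmetric.
data Linked {k n} (F : Pred (String k (suc n)) 0ℓ) : String k (suc n) → String k (suc n) → Set where
  rotation : ∀ {w} → w ∈ F → Linked F w (rotate w)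
  newHead  : ∀ {u v} → u ∈ F → v ∈ F → tail u ≡ tail v → Linked F u v
  lrefl    : ∀ {w} → Linked F w w
  lsym     : ∀ {u v} → Linked F u v → Linked F v u
  ltrans   : ∀ {u v w} → Linked F u v → Linked F v w → Linked F u w

-- In graph terms a word is an arc, from its first `n` letters to its last `n` letters. A successor
-- permutation splits the arcs in `F` into closed trails, and two trails that enter a common vertex
-- are spliced there.
module Eulerian {k n} (F : Pred (String k (suc n)) 0ℓ) (F? : Decidable F)
                (F-rotate : ∀ {w} → w ∈ F → rotate w ∈ F) where

  Word : Set
  Word = String k (suc n)

  encode : Word → Fin (k ^ suc n)
  encode w = funToFin (lookup w)

  decode : Fin (k ^ suc n) → Word
  decode i = tabulate (finToFun i)

  decode-encode : ∀ w → decode (encode w) ≡ w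
  decode-encode w = trans (tabulate-cong (finToFun-funToFin (lookup w))) (tabulate∘lookup w)

  encode-injective : Injective _≡_ _≡_ encode
  encode-injective {u} {v} eq =
    trans (sym (decode-encode u)) (trans (cong decode eq) (decode-encode v))

  open Orbits encode encode-injective

  allPairs : List (Word × Word)
  allPairs = cartesianProduct allWords allWords
    where allWords = List.map decode (allFin _)

  ∈-allPairs : ∀ u v → (u , v) ∈ˡ allPairs
  ∈-allPairs u v = ∈-cartesianProduct⁺ (∈-allWords u) (∈-allWords v)
    where
    ∈-allWords : ∀ w → w ∈ˡ List.map decode (allFin _)
    ∈-allWords w = subst (_∈ˡ _) (decode-encode w) (∈-map⁺ decode (∈-allFin (encode w)))

  -- The map permutes all words and keeps `F` invariant, so an orbit that starts in `F` stays there.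
  -- `shifts` leaves only the last letter of `π w` free.
  record IsSuccessor (π : Word → Word) : Set where
    field
      injective : Injective _≡_ _≡_ π
      preserves : ∀ {w} → w ∈ F → π w ∈ F
      shifts    : ∀ w i → lookup (π w) (inject₁ i) ≡ lookup w (suc i)

  open IsSuccessor

  rotate-isSuccessor : IsSuccessor rotate
  rotate-isSuccessor .injective = rotate-injective
  rotate-isSuccessor .preserves = F-rotate
  rotate-isSuccessor .shifts    = lookup-rotate

  -- `shifts` depends on the tail of a word only, so words with equal tails may exchange their
  -- successors.
  swapped-isSuccessor : ∀ {π} → IsSuccessor π → ∀ {u v} → u ∈ F → v ∈ F →
                        tail u ≡ tail v → IsSuccessor (π ∘ swapped u v)
  swapped-isSuccessor π-succ {u} {v} u∈F v∈F tails .injective =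
    swapped-injective u v ∘ π-succ .injective
  swapped-isSuccessor π-succ {u} {v} u∈F v∈F tails .preserves {w} w∈F =
    π-succ .preserves (swapped-cases (λ x y → x ∈ F → y ∈ F)
      (λ _ → v∈F) (λ _ → u∈F) (λ _ x∈F → x∈F) w w∈F)
  swapped-isSuccessor π-succ {u@(_ ∷ _)} {v@(_ ∷ _)} u∈F v∈F refl .shifts w i =
    trans (π-succ .shifts _ i)
      (swapped-cases (λ x y → lookup y (suc i) ≡ lookup x (suc i)) refl refl (λ _ → refl) w)

  Joins : (Word → Word) → Word × Word → Set
  Joins π (u , v) = u ∈ F → v ∈ F → tail u ≡ tail v → Reach π u v

  -- Starting from `rotate`, one pair is treated at a time: if its words are still apart, their
  -- orbits are merged, and `merged-mono` keeps every join made so far.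
  joinPairs : ∀ ps → ∃ λ π → IsSuccessor π × (∀ {p} → p ∈ˡ ps → Joins π p)
  joinPairs [] = rotate , rotate-isSuccessor , λ ()
  joinPairs ((u , v) ∷ ps) with joinPairs ps
  ... | π , π-succ , joins
      with F? u | F? v | ≡-dec _≟_ (tail u) (tail v)
         | Permutation.reach? (π-succ .injective) u v
  ... | no u∉F  | _       | _         | _ =
    π , π-succ , λ { (here refl) u∈F _ _ → contradiction u∈F u∉F ; (there p) → joins p }
  ... | yes _   | no v∉F  | _         | _ =
    π , π-succ , λ { (here refl) _ v∈F _ → contradiction v∈F v∉F ; (there p) → joins p }
  ... | yes _   | yes _   | no differ | _ =
    π , π-succ , λ { (here refl) _ _ eq → contradiction eq differ ; (there p) → joins p }
  ... | yes _   | yes _   | yes _     | yes u→v =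
    π , π-succ , λ { (here refl) _ _ _ → u→v ; (there p) → joins p }
  ... | yes u∈F | yes v∈F | yes tails | no u↛v =
    merged , swapped-isSuccessor π-succ u∈F v∈F tails ,
    λ { (here refl) _ _ _ → left→right
      ; (there p) x∈F y∈F eq → merged-mono (joins p x∈F y∈F eq) }
    where open Merge (π-succ .injective) u↛v

  module _ {π} (π-succ : IsSuccessor π) where

    open Permutation (π-succ .injective)

    fold-preserves : ∀ {w} → w ∈ F → ∀ m → fold w π m ∈ F
    fold-preserves w∈F zero    = w∈F
    fold-preserves w∈F (suc m) = π-succ .preserves (fold-preserves w∈F m)

    -- Each step moves all letters one place to the left, so the letter at `i` arrives at the front
    -- after `i` steps.
    lookup≡head-fold : ∀ w i → lookup w i ≡ head (fold w π (toℕ i))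
    lookup≡head-fold w i = go (toℕ i) w i refl
      where
      go : ∀ m w i → toℕ i ≡ m → lookup w i ≡ head (fold w π m)
      go zero    (x ∷ w) zero    _  = refl
      go (suc m) w       (suc i) eq = begin
        lookup w (suc i)           ≡⟨ π-succ .shifts w i ⟨
        lookup (π w) (inject₁ i)   ≡⟨ go m (π w) (inject₁ i) (trans (toℕ-inject₁ i) (cong pred eq)) ⟩
        head (fold (π w) π m)      ≡⟨ cong head (fold-step w m) ⟩
        head (fold w π (suc m))    ∎
        where open ≡-Reasoning

    module _ (joins : ∀ u v → Joins π (u , v)) where

      -- rotate w and the π-preimage u of rotate w satisfy tail u ≡ tail w.
      reach-rotate : ∀ {w} → w ∈ F → Reach π w (rotate w)
      reach-rotate {w@(_ ∷ _)} w∈F with preimageOf (rotate w)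
      ... | u@(_ ∷ _) , πu≡ , m , eq =
        reach-trans (joins w u w∈F (subst F eq (fold-preserves (F-rotate w∈F) m)) (vec-ext λ i → begin
            lookup w (suc i)               ≡⟨ lookup-rotate w i ⟨
            lookup (rotate w) (inject₁ i)  ≡⟨ cong (λ z → lookup z (inject₁ i)) πu≡ ⟨
            lookup (π u) (inject₁ i)       ≡⟨ π-succ .shifts u i ⟩
            lookup u (suc i)               ∎))
          (reach-step πu≡)
        where open ≡-Reasoning

      linked⇒reach : ∀ {u v} → Linked F u v → Reach π u v
      linked⇒reach (rotation w∈F)             = reach-rotate w∈F
      linked⇒reach (newHead u∈F v∈F tails)    = joins _ _ u∈F v∈F tails
      linked⇒reach lrefl                      = reach-refl
      linked⇒reach (lsym l)                   = reach-sym (linked⇒reach l)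
      linked⇒reach (ltrans l l′)              = reach-trans (linked⇒reach l) (linked⇒reach l′)

      -- The cyclic sequence consists of the first letters along the orbit of `w₀`, so its windows
      -- are the words of the orbit. They lie in `F` by invariance, exhaust `F` by connectivity and
      -- are distinct within the least period.
      orbitUcycle : ∀ w₀ → w₀ ∈ F → (∀ {w} → w ∈ F → Linked F w₀ w) → Ucycle F
      orbitUcycle w₀ w₀∈F connected with leastPeriod w₀
      ... | mkLeastPeriod p returns distinct = record
        { N        = N
        ; sequence = sequence
        ; isUcycle = record
          { window∈F    = λ i → subst F (sym (window≡ i)) (fold-preserves w₀∈F (toℕ i))
          ; exactlyOnce = once
          }
        }
        where
        N = suc p

        letter : Fin N → Fin k
        letter i = head (fold w₀ π (toℕ i))

        sequence : String k N
        sequence = tabulate letter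

        window≡ : ∀ i → window sequence (suc n) i ≡ fold w₀ π (toℕ i)
        window≡ i = vec-ext λ j → let m = toℕ i + toℕ j in begin
          lookup (window sequence (suc n) i) j     ≡⟨ lookup∘tabulate (λ j → lookup sequence ((toℕ i + toℕ j) mod N)) j ⟩
          lookup sequence (m mod N)                ≡⟨ lookup∘tabulate letter (m mod N) ⟩
          head (fold w₀ π (toℕ (m mod N)))         ≡⟨ cong (head ∘ fold w₀ π) (toℕ-fromℕ< (m%n<n m N)) ⟩
          -- `N` is a period of the orbit, so the reduction of the index can be undone, also when
          -- the window is longer than the sequence.
          head (fold w₀ π (m % N))                 ≡⟨ cong head (fold-% returns m) ⟨
          head (fold w₀ π m)                       ≡⟨ cong (head ∘ fold w₀ π) (+-comm (toℕ i) (toℕ j)) ⟩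
          head (fold w₀ π (toℕ j + toℕ i))         ≡⟨ cong head (fold-+ w₀ π (toℕ j)) ⟩
          head (fold (fold w₀ π (toℕ i)) π (toℕ j)) ≡⟨ lookup≡head-fold (fold w₀ π (toℕ i)) j ⟨
          lookup (fold w₀ π (toℕ i)) j             ∎
          where open ≡-Reasoning

        once : ∀ {s} → s ∈ F → ∃! _≡_ λ i → window sequence (suc n) i ≡ s
        once s∈F with reach-bounded returns (linked⇒reach (connected s∈F))
        ... | i , eq = i , trans (window≡ i) eq ,
          λ {j} eq′ → distinct (trans eq (trans (sym eq′) (window≡ j)))

  ucycle : ∀ w₀ → w₀ ∈ F → (∀ {w} → w ∈ F → Linked F w₀ w) → Ucycle F
  ucycle with joinPairs allPairs
  ... | π , π-succ , joins = orbitUcycle π-succ (λ u v → joins (∈-allPairs u v))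

-- Letter counts

-- The Kronecker delta, written with the same `does` test as `preimage`.
δ : ∀ {k} → Fin k → Fin k → ℕ
δ x c = if does (x ≟ c) then 1 else 0

δ-refl : ∀ {k} (x : Fin k) → δ x x ≡ 1
δ-refl x with x ≟ x
... | yes _  = refl
... | no x≢x = contradiction refl x≢x

δ-≢ : ∀ {k} {x c : Fin k} → x ≢ c → δ x c ≡ 0
δ-≢ {x = x} {c} x≢c with x ≟ c
... | yes x≡c = contradiction x≡c x≢c
... | no _    = refl

sum-δ : ∀ {k} (x : Fin k) → sum (δ x) ≡ 1
sum-δ {suc k} zero    = cong suc (sum-replicate-zero k)
sum-δ         (suc x) = sum-δ x

module _ {k : ℕ} where

  count : ∀ {n} → String k n → Fin k → ℕ
  count w = preimageCardinality (lookup w)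

  count-∷ : ∀ {n} x (v : String k n) c → count (x ∷ v) c ≡ δ x c + count v c
  count-∷ x v c with does (x ≟ c)
  ... | true  = refl
  ... | false = refl

  count-∷ʳ : ∀ {n} x (v : String k n) c → count (v ∷ʳ x) c ≡ δ x c + count v c
  count-∷ʳ x []      c = count-∷ x [] c
  count-∷ʳ x (y ∷ v) c = begin
    count (y ∷ (v ∷ʳ x)) c         ≡⟨ count-∷ y (v ∷ʳ x) c ⟩
    δ y c + count (v ∷ʳ x) c       ≡⟨ cong (δ y c +_) (count-∷ʳ x v c) ⟩
    δ y c + (δ x c + count v c)    ≡⟨ swapHeads (δ y c) (δ x c) (count v c) ⟩
    δ x c + (δ y c + count v c)    ≡⟨ cong (δ x c +_) (count-∷ y v c) ⟨
    δ x c + count (y ∷ v) c        ∎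
    where
    open ≡-Reasoning
    swapHeads : ∀ a b d → a + (b + d) ≡ b + (a + d)
    swapHeads = solve-∀

  count-rotate : ∀ {n} (w : String k (suc n)) c → count (rotate w) c ≡ count w c
  count-rotate (x ∷ v) c = trans (count-∷ʳ x v c) (sym (count-∷ x v c))

  count-replicate-++ : ∀ {n} m x (v : String k n) c →
                       count (replicate m x ++ v) c ≡ m * δ x c + count v c
  count-replicate-++ zero    x v c = refl
  count-replicate-++ (suc m) x v c = begin
    count (x ∷ replicate m x ++ v) c        ≡⟨ count-∷ x (replicate m x ++ v) c ⟩
    δ x c + count (replicate m x ++ v) c    ≡⟨ cong (δ x c +_) (count-replicate-++ m x v c) ⟩
    δ x c + (m * δ x c + count v c)         ≡⟨ +-assoc (δ x c) (m * δ x c) (count v c) ⟨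
    suc m * δ x c + count v c               ∎
    where open ≡-Reasoning

  -- Both sides are moved so that no subtraction occurs.
  count-[]≔ : ∀ {n} (w : String k n) i y c →
              count (w [ i ]≔ y) c + δ (lookup w i) c ≡ count w c + δ y c
  count-[]≔ (x ∷ v) zero y c = begin
    count (y ∷ v) c + δ x c        ≡⟨ cong (_+ δ x c) (count-∷ y v c) ⟩
    δ y c + count v c + δ x c      ≡⟨ reverse (δ y c) (count v c) (δ x c) ⟩
    δ x c + count v c + δ y c      ≡⟨ cong (_+ δ y c) (count-∷ x v c) ⟨
    count (x ∷ v) c + δ y c        ∎
    where
    open ≡-Reasoning
    reverse : ∀ a b d → a + b + d ≡ d + b + a
    reverse = solve-∀
  count-[]≔ (x ∷ v) (suc i) y c = begin
    count (x ∷ v [ i ]≔ y) c + δ z c          ≡⟨ cong (_+ δ z c) (count-∷ x (v [ i ]≔ y) c) ⟩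
    δ x c + count (v [ i ]≔ y) c + δ z c      ≡⟨ +-assoc (δ x c) _ _ ⟩
    δ x c + (count (v [ i ]≔ y) c + δ z c)    ≡⟨ cong (δ x c +_) (count-[]≔ v i y c) ⟩
    δ x c + (count v c + δ y c)               ≡⟨ +-assoc (δ x c) _ _ ⟨
    δ x c + count v c + δ y c                 ≡⟨ cong (_+ δ y c) (count-∷ x v c) ⟨
    count (x ∷ v) c + δ y c                   ∎
    where
    open ≡-Reasoning
    z = lookup v i

  module _ {n} (w : String k n) i {a} (wᵢ≡a : lookup w i ≡ a) {b} (a≢b : a ≢ b) where

    private
      updated : ∀ c → count (w [ i ]≔ b) c + δ a c ≡ count w c + δ b c
      updated c = subst (λ x → count (w [ i ]≔ b) c + δ x c ≡ count w c + δ b c) wᵢ≡a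
                        (count-[]≔ w i b c)

    count-[]≔-old : suc (count (w [ i ]≔ b) a) ≡ count w a
    count-[]≔-old = begin
      suc (count (w [ i ]≔ b) a)      ≡⟨ +-comm 1 _ ⟩
      count (w [ i ]≔ b) a + 1        ≡⟨ cong (count (w [ i ]≔ b) a +_) (δ-refl a) ⟨
      count (w [ i ]≔ b) a + δ a a    ≡⟨ updated a ⟩
      count w a + δ b a               ≡⟨ cong (count w a +_) (δ-≢ (a≢b ∘ sym)) ⟩
      count w a + 0                   ≡⟨ +-identityʳ _ ⟩
      count w a                       ∎
      where open ≡-Reasoning

    count-[]≔-new : count (w [ i ]≔ b) b ≡ suc (count w b)
    count-[]≔-new = begin
      count (w [ i ]≔ b) b            ≡⟨ +-identityʳ _ ⟨
      count (w [ i ]≔ b) b + 0        ≡⟨ cong (count (w [ i ]≔ b) b +_) (δ-≢ a≢b) ⟨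
      count (w [ i ]≔ b) b + δ a b    ≡⟨ updated b ⟩
      count w b + δ b b               ≡⟨ cong (count w b +_) (δ-refl b) ⟩
      count w b + 1                   ≡⟨ +-comm _ 1 ⟩
      suc (count w b)                 ∎
      where open ≡-Reasoning

    count-[]≔-other : ∀ {c} → c ≢ a → c ≢ b → count (w [ i ]≔ b) c ≡ count w c
    count-[]≔-other {c} c≢a c≢b = begin
      count (w [ i ]≔ b) c            ≡⟨ +-identityʳ _ ⟨
      count (w [ i ]≔ b) c + 0        ≡⟨ cong (count (w [ i ]≔ b) c +_) (δ-≢ (c≢a ∘ sym)) ⟨
      count (w [ i ]≔ b) c + δ a c    ≡⟨ updated c ⟩
      count w c + δ b c               ≡⟨ cong (count w c +_) (δ-≢ (c≢b ∘ sym)) ⟩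
      count w c + 0                   ≡⟨ +-identityʳ _ ⟩
      count w c                       ∎
      where open ≡-Reasoning

  lookup⇒∈preimage : ∀ {n} (w : String k n) {i c} → lookup w i ≡ c → i Subset.∈ preimage (lookup w) c
  lookup⇒∈preimage w {i} {c} eq = lookup⇒[]= i _
    (trans (lookup∘tabulate (λ j → does (lookup w j ≟ c)) i) (dec-true (lookup w i ≟ c) eq))

  ∈preimage⇒lookup : ∀ {n} (w : String k n) {i c} → i Subset.∈ preimage (lookup w) c → lookup w i ≡ c
  ∈preimage⇒lookup w {i} {c} i∈ with lookup w i ≟ c
      | trans (sym (lookup∘tabulate (λ j → does (lookup w j ≟ c)) i)) ([]=⇒lookup i∈)
  ... | yes eq | _ = eq
  ... | no _   | ()

  -- Otherwise the positions of `c` in `u` would all be positions of `c` in `v`, with `i` missing,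
  -- and the counts could not agree.
  surplus : ∀ {n} (u v : String k n) {i c} → count u c ≡ count v c →
            lookup v i ≡ c → lookup u i ≢ c → ∃ λ j → lookup u j ≡ c × lookup v j ≢ c
  surplus u v {i} {c} eq vᵢ≡c uᵢ≢c
    with any? (λ j → (lookup u j ≟ c) ×-dec ¬? (lookup v j ≟ c))
  ... | yes found = found
  ... | no none   = contradiction eq (<⇒≢ (p⊂q⇒∣p∣<∣q∣
        (contained , i , lookup⇒∈preimage v vᵢ≡c , uᵢ≢c ∘ ∈preimage⇒lookup u)))
    where
    contained : ∀ {j} → j Subset.∈ preimage (lookup u) c → j Subset.∈ preimage (lookup v) c
    contained {j} j∈ with lookup v j ≟ c
    ... | yes vⱼ≡c = lookup⇒∈preimage v vⱼ≡c
    ... | no vⱼ≢c  = contradiction (j , ∈preimage⇒lookup u j∈ , vⱼ≢c) none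

  occurs : ∀ {n} (w : String k n) {c} → 0 < count w c → ∃ λ i → lookup w i ≡ c
  occurs (x ∷ v) {c} pos with x ≟ c
  ... | yes x≡c = zero , x≡c
  ... | no _ with i , eq ← occurs v pos = suc i , eq

  count-positive : ∀ {n} (w : String k n) i → 0 < count w (lookup w i)
  count-positive (x ∷ v) zero rewrite count-∷ x v x | δ-refl x = z<s
  count-positive (x ∷ v) (suc i) rewrite count-∷ x v (lookup v i) =
    ≤-trans (count-positive v i) (m≤n+m _ _)

  sum-count : ∀ {n} (w : String k n) → sum (count w) ≡ n
  sum-count []      = sum-replicate-zero k
  sum-count (x ∷ v) = begin
    sum (count (x ∷ v))           ≡⟨ sum-cong-≗ (count-∷ x v) ⟩
    sum (λ c → δ x c + count v c) ≡⟨ ∑-distrib-+ (δ x) (count v) ⟩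
    sum (δ x) + sum (count v)     ≡⟨ cong₂ _+_ (sum-δ x) (sum-count v) ⟩
    suc _                         ∎
    where open ≡-Reasoning

count-map-suc-zero : ∀ {k n} (v : String k n) → count (map suc v) zero ≡ 0
count-map-suc-zero []      = refl
count-map-suc-zero (x ∷ v) = count-map-suc-zero v

count-map-suc : ∀ {k n} (v : String k n) c → count (map suc v) (suc c) ≡ count v c
count-map-suc []      c = refl
count-map-suc (x ∷ v) c = trans (count-∷ (suc x) (map suc v) (suc c))
  (trans (cong (δ x c +_) (count-map-suc v c)) (sym (count-∷ x v c)))

-- The word is a sequence of blocks of equal letters, in the order of the alphabet.
realize : ∀ {k} (f : Fin k → ℕ) → ∃ λ (w : String k (sum f)) → ∀ c → count w c ≡ f c
realize {zero}  f = [] , λ ()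
realize {suc k} f with v , counts ← realize (f ∘ suc) =
  replicate (f zero) zero ++ map suc v , λ where
    zero    → trans (count-replicate-++ (f zero) zero (map suc v) zero)
                (trans (cong₂ _+_ (*-identityʳ (f zero)) (count-map-suc-zero v)) (+-identityʳ (f zero)))
    (suc c) → trans (count-replicate-++ (f zero) zero (map suc v) (suc c))
                (trans (cong₂ _+_ (*-zeroʳ (f zero)) (count-map-suc v c)) (counts c))

-- Exchanging two positions of a word

module _ {k n : ℕ} where

  swap : String k n → Fin n → Fin n → String k n
  swap w p q = (w [ p ]≔ lookup w q) [ q ]≔ lookup w p

  module _ (w : String k n) {p q : Fin n} (p≢q : p ≢ q) where

    lookup-swap-left : lookup (swap w p q) p ≡ lookup w q
    lookup-swap-left = trans (lookup∘update′ p≢q (w [ p ]≔ lookup w q) _) (lookup∘update p w _)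

    lookup-swap-right : lookup (swap w p q) q ≡ lookup w p
    lookup-swap-right = lookup∘update q (w [ p ]≔ lookup w q) _

    lookup-swap-other : ∀ {i} → i ≢ p → i ≢ q → lookup (swap w p q) i ≡ lookup w i
    lookup-swap-other i≢p i≢q =
      trans (lookup∘update′ i≢q (w [ p ]≔ lookup w q) _) (lookup∘update′ i≢p w _)

    -- Allows an exchange to be carried out while a third position `r` is temporarily overwritten.
    swap-[]≔ : ∀ {r} b → r ≢ p → r ≢ q → swap (w [ r ]≔ b) p q ≡ swap w p q [ r ]≔ b
    swap-[]≔ {r} b r≢p r≢q = begin
      swap (w [ r ]≔ b) p q                                  ≡⟨ cong₂ (λ x y → ((w [ r ]≔ b) [ p ]≔ x) [ q ]≔ y)
                                                                  (lookup∘update′ (r≢q ∘ sym) w b)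
                                                                  (lookup∘update′ (r≢p ∘ sym) w b) ⟩
      ((w [ r ]≔ b) [ p ]≔ lookup w q) [ q ]≔ lookup w p     ≡⟨ cong (_[ q ]≔ lookup w p) ([]≔-commutes w r p r≢p) ⟩
      ((w [ p ]≔ lookup w q) [ r ]≔ b) [ q ]≔ lookup w p     ≡⟨ []≔-commutes (w [ p ]≔ lookup w q) r q r≢q ⟩
      swap w p q [ r ]≔ b                                    ∎
      where open ≡-Reasoning

    count-swap : ∀ c → count (swap w p q) c ≡ count w c
    count-swap c = +-cancelʳ-≡ (δ (lookup w q) c) _ _ (begin
      count (swap w p q) c + δ (lookup w q) c     ≡⟨ cong (λ x → count (swap w p q) c + δ x c) (lookup∘update′ (p≢q ∘ sym) w (lookup w q)) ⟨
      count (swap w p q) c + δ (lookup u q) c     ≡⟨ count-[]≔ u q (lookup w p) c ⟩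
      count u c + δ (lookup w p) c                ≡⟨ count-[]≔ w p (lookup w q) c ⟩
      count w c + δ (lookup w q) c                ∎)
      where
      open ≡-Reasoning
      u = w [ p ]≔ lookup w q

-- Connectivity

-- The number of positions taken by the letters below the top one when their counts are as small as
-- possible.
triangle : ℕ → ℕ
triangle m = sum {m} (λ i → suc (toℕ i))

triangle-suc : ∀ m → triangle (suc m) ≡ triangle m + suc m
triangle-suc m = trans (sum-init-last {m} (λ i → suc (toℕ i)))
  (cong₂ _+_ (sum-cong-≗ {m} {λ i → suc (toℕ (inject₁ i))} (cong suc ∘ toℕ-inject₁)) (cong suc (toℕ-fromℕ m)))

triangle-double : ∀ m → triangle m * 2 ≡ m * suc m
triangle-double zero    = refl
triangle-double (suc m) = begin
  triangle (suc m) * 2         ≡⟨ cong (_* 2) (triangle-suc m) ⟩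
  (triangle m + suc m) * 2     ≡⟨ *-distribʳ-+ 2 (triangle m) (suc m) ⟩
  triangle m * 2 + suc m * 2   ≡⟨ cong (_+ suc m * 2) (triangle-double m) ⟩
  m * suc m + suc m * 2        ≡⟨ rearrange m ⟩
  suc m * suc (suc m)          ∎
  where
  open ≡-Reasoning
  rearrange : ∀ m → m * suc m + suc m * 2 ≡ suc m * suc (suc m)
  rearrange = solve-∀

-- The length bound for `suc m` letters: the smaller letters take at least `triangle m` positions,
-- and `2m + 1` more are set aside for the top letter.
bound≡triangle : ∀ m → (suc m + 4) * m / 2 + 1 ≡ suc (m + m) + triangle m
bound≡triangle m = begin
  (suc m + 4) * m / 2 + 1              ≡⟨ cong (λ e → e / 2 + 1) double ⟩
  (triangle m + (m + m)) * 2 / 2 + 1   ≡⟨ cong (_+ 1) (m*n/n≡m (triangle m + (m + m)) 2) ⟩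
  triangle m + (m + m) + 1             ≡⟨ rearrange (triangle m) (m + m) ⟩
  suc (m + m) + triangle m             ∎
  where
  open ≡-Reasoning
  rearrange : ∀ t d → t + d + 1 ≡ suc d + t
  rearrange = solve-∀
  expand : ∀ m → (suc m + 4) * m ≡ m * suc m + (m + m) * 2
  expand = solve-∀
  double : (suc m + 4) * m ≡ (triangle m + (m + m)) * 2
  double = trans (expand m) (trans (cong (_+ (m + m) * 2) (sym (triangle-double m)))
             (sym (*-distribʳ-+ 2 (triangle m) (m + m))))

-- Positive counts stand for surjectivity, so that the property depends on the counts alone and is
-- decidable by finite checks.
record Increasing {k n} (w : String k n) : Set where
  field
    positive : ∀ c → 0 < count w c
    strict   : ∀ {c d} → toℕ c < toℕ d → count w c < count w d

open Increasing

module _ {k n : ℕ} where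

  increasing-resp-count : ∀ {u v : String k n} → (∀ c → count v c ≡ count u c) →
                          Increasing u → Increasing v
  increasing-resp-count eq inc .positive c       = subst (0 <_) (sym (eq c)) (inc .positive c)
  increasing-resp-count eq inc .strict {c} {d} l =
    subst₂ _<_ (sym (eq c)) (sym (eq d)) (inc .strict l)

  increasing? : Decidable (Increasing {k} {n})
  increasing? w = map′ (λ (p , s) → record { positive = p ; strict = λ {c} {d} → s c d })
    (λ inc → inc .positive , λ c d → inc .strict)
    (all? (λ c → 0 <? count w c) ×-dec
     all? (λ c → all? (λ d → toℕ c <? toℕ d →-dec count w c <? count w d)))

  increasing⇒onto : ∀ {w} → Increasing w → w ∈ OntoIncreasingStrings k n
  increasing⇒onto {w} inc = (λ c → let i , eq = occurs w (inc .positive c) in i , λ { refl → eq })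
                          , inc .strict

  onto⇒increasing : ∀ {w} → w ∈ OntoIncreasingStrings k n → Increasing w
  onto⇒increasing {w} (onto , strict) = record
    { positive = λ c → let i , eq = onto c in subst (λ c → 0 < count w c) (eq refl) (count-positive w i)
    ; strict   = strict
    }

-- The counts start at 1 or more and grow by at least one from each letter to the next.
increasing-bound : ∀ {k n} {w : String k n} → Increasing w → ∀ c → toℕ c < count w c
increasing-bound {w = w} inc c = go (toℕ c) c refl
  where
  go : ∀ m c → toℕ c ≡ m → m < count w c
  go zero    c       _  = inc .positive c
  go (suc m) (suc c) eq = ≤-<-trans
    (go m (inject₁ c) (trans (toℕ-inject₁ c) (suc-injective eq)))
    (inc .strict (s≤s (≤-reflexive (toℕ-inject₁ c))))

Ucycle-resp-⇔ : ∀ {k n} {F G : Pred (String k n) 0ℓ} →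
                (∀ {w} → w ∈ F → w ∈ G) → (∀ {w} → w ∈ G → w ∈ F) → Ucycle F → Ucycle G
Ucycle-resp-⇔ F⇒G G⇒F u = record
  { sequence = sequence
  ; isUcycle = record
    { window∈F    = F⇒G ∘ window∈F
    ; exactlyOnce = exactlyOnce ∘ G⇒F
    }
  }
  where
  open Ucycle u
  open IsUcycle isUcycle

-- The alphabet has `suc k` letters here, so `k` is the index of the largest letter and also the
-- number of letters below it.
module Connectivity (k n : ℕ) where

  F : Pred (String (suc k) (suc n)) 0ℓ
  F = Increasing

  Word : Set
  Word = String (suc k) (suc n)

  top : Fin (suc k)
  top = fromℕ k

  F-rotate : ∀ {w} → w ∈ F → rotate w ∈ F
  F-rotate {w} = increasing-resp-count (count-rotate w)

  -- Rotating both words brings the changed position to the front, where the change is a `newHead`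
  -- move; the second word is then rotated back.
  linked-[]≔ : ∀ (w : Word) i y → w ∈ F → w [ i ]≔ y ∈ F → Linked F w (w [ i ]≔ y)
  linked-[]≔ w i y = go (toℕ i) w i refl
    where
    go : ∀ m w i → toℕ i ≡ m → w ∈ F → w [ i ]≔ y ∈ F → Linked F w (w [ i ]≔ y)
    go zero    (x ∷ v) zero    _  w∈F w′∈F = newHead w∈F w′∈F refl
    go (suc m) (x ∷ v) (suc i) eq w∈F w′∈F = ltrans (rotation w∈F) (ltrans
      (go m (v ∷ʳ x) (inject₁ i) (trans (toℕ-inject₁ i) (suc-injective eq)) (F-rotate w∈F)
          (subst F (∷ʳ-[]≔ v x i y) (F-rotate w′∈F)))
      (lsym (subst (Linked F _) (∷ʳ-[]≔ v x i y) (rotation w′∈F))))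

  <⇒≢top : ∀ {c : Fin (suc k)} → toℕ c < k → c ≢ top
  <⇒≢top c<k refl = <-irrefl (toℕ-fromℕ k) c<k

  ≢top⇒< : ∀ {c} → c ≢ top → toℕ c < k
  ≢top⇒< {c} c≢top = ≤∧≢⇒< (toℕ≤pred[n] c) (λ eq → c≢top (toℕ-injective (trans eq (sym (toℕ-fromℕ k)))))

  -- Reduction to the smallest counts

  Bottom : Word → Set
  Bottom w = ∀ c → c ≢ top → count w c ≡ suc (toℕ c)

  AtBottom : Word → Fin (suc k) → Set
  AtBottom w c = c ≡ top ⊎ count w c ≡ suc (toℕ c)

  atBottom? : ∀ w → Decidable (AtBottom w)
  atBottom? w c = (c ≟ top) ⊎-dec (count w c ℕ.≟ suc (toℕ c))

  -- While some letter below the top exceeds its least possible count, one occurrence of the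
  -- smallest such letter `a` is changed into `top`. All letters below `a` have their exact counts,
  -- so `a` still exceeds them. The count of `top` grows each time and is bounded by the length,
  -- which limits the number of rounds.
  toBottom : ∀ {w} → w ∈ F → ∃ λ u → u ∈ F × Linked F w u × Bottom u
  toBottom {w} w∈F = go (suc n) w w∈F (m≤n+m (suc n) (count w top))
    where
    go : ∀ fuel w → w ∈ F → suc n ≤ count w top + fuel →
         ∃ λ u → u ∈ F × Linked F w u × Bottom u
    go fuel w w∈F enough with all? (atBottom? w)
    ... | yes atBottom = w , w∈F , lrefl , λ c c≢top → fromInj₂ (λ c≡top → contradiction c≡top c≢top) (atBottom c)
    ... | no ¬atBottom
        with ¬∀⟶∃¬-smallest _ (AtBottom w) (atBottom? w) ¬atBottom
    ... | a , ¬a , below = continue fuel enough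
      where
      a≢top : a ≢ top
      a≢top = ¬a ∘ inj₁

      2+a≤ : 2 + toℕ a ≤ count w a
      2+a≤ = ≤∧≢⇒< (increasing-bound w∈F a) (λ eq → ¬a (inj₂ (sym eq)))

      exact : ∀ {c} → toℕ c < toℕ a → count w c ≡ suc (toℕ c)
      exact {c} c<a with subst (AtBottom w)
          (toℕ-injective (trans (toℕ-inject (fromℕ< c<a)) (toℕ-fromℕ< c<a))) (below (fromℕ< c<a))
      ... | inj₁ c≡top = contradiction c≡top (<⇒≢top (<-trans c<a (≢top⇒< a≢top)))
      ... | inj₂ eq    = eq

      occurrence : ∃ λ i → lookup w i ≡ a
      occurrence = occurs w (w∈F .positive a)

      i = proj₁ occurrence
      w′ = w [ i ]≔ top

      at-a : suc (count w′ a) ≡ count w a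
      at-a = count-[]≔-old w i (proj₂ occurrence) a≢top

      at-top : count w′ top ≡ suc (count w top)
      at-top = count-[]≔-new w i (proj₂ occurrence) a≢top

      elsewhere : ∀ {c} → c ≢ a → c ≢ top → count w′ c ≡ count w c
      elsewhere = count-[]≔-other w i (proj₂ occurrence) a≢top

      1+a≤ : suc (toℕ a) ≤ count w′ a
      1+a≤ = s≤s⁻¹ (subst (2 + toℕ a ≤_) (sym at-a) 2+a≤)

      grows : ∀ c → c ≢ a → count w c ≤ count w′ c
      grows c c≢a with c ≟ top
      ... | yes refl  = ≤-trans (n≤1+n _) (≤-reflexive (sym at-top))
      ... | no c≢top  = ≤-reflexive (sym (elsewhere c≢a c≢top))

      shrinks : ∀ c → c ≢ top → count w′ c ≤ count w c
      shrinks c c≢top with c ≟ a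
      ... | yes refl = ≤-trans (n≤1+n _) (≤-reflexive at-a)
      ... | no c≢a   = ≤-reflexive (elsewhere c≢a c≢top)

      w′∈F : w′ ∈ F
      w′∈F .positive c with c ≟ a
      ... | yes refl = ≤-trans (s≤s z≤n) 1+a≤
      ... | no c≢a   = ≤-trans (w∈F .positive c) (grows c c≢a)
      w′∈F .strict {c} {d} c<d with d ≟ a
      ... | yes refl = subst (_< count w′ d)
              (sym (trans (elsewhere (<⇒≢ c<d ∘ cong toℕ) (<⇒≢top (<-trans c<d (≢top⇒< a≢top)))) (exact c<d)))
              (≤-trans (s≤s c<d) 1+a≤)
      ... | no d≢a   = ≤-<-trans (shrinks c (<⇒≢top (<-≤-trans c<d (toℕ≤pred[n] d))))
                         (<-≤-trans (w∈F .strict c<d) (grows d d≢a))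

      continue : ∀ fuel → suc n ≤ count w top + fuel →
                 ∃ λ u → u ∈ F × Linked F w u × Bottom u
      -- Without fuel the whole word already consists of top letters, and `w′` would contain one
      -- more than its length.
      continue zero enough = contradiction
        (subst (_≤ suc n) at-top (∣p∣≤n (preimage (lookup w′) top)))
        (<⇒≱ (s≤s (≤-trans enough (≤-reflexive (+-identityʳ _)))))
      continue (suc fuel) enough
        with u , u∈F , l , bottom ← go fuel w′ w′∈F
               (≤-trans enough (≤-reflexive (trans (+-suc _ fuel) (cong (_+ fuel) (sym at-top))))) =
        u , u∈F , ltrans (linked-[]≔ w i top w∈F w′∈F) l , bottom

  -- The contents obtained from the bottom one by moving one unit from the top
  -- letter to each of the letters t, …, k - 1.
  record Raised (t : ℕ) (w : Word) : Set where
    field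
      low  : ∀ {c} → toℕ c < t → count w c ≡ suc (toℕ c)
      high : ∀ {c} → t ≤ toℕ c → c ≢ top → count w c ≡ 2 + toℕ c
      many : suc (k + t) ≤ count w top

  open Raised

  raised-resp-count : ∀ {t u v} → (∀ c → count v c ≡ count u c) → Raised t u → Raised t v
  raised-resp-count eq level .low  {c} c<t       = trans (eq c) (level .low c<t)
  raised-resp-count eq level .high {c} t≤c c≢top = trans (eq c) (level .high t≤c c≢top)
  raised-resp-count eq level .many               = subst (_ ≤_) (sym (eq top)) (level .many)

  -- Adding one to all letters from `t` up to the top keeps their order. The raised letters have
  -- counts at most `k + 1`, and the top letter has at least `k + t + 1`, which is larger exactly
  -- because `t` is positive.
  level⇒∈ : ∀ {t w} → 0 < t → Raised t w → w ∈ F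
  level⇒∈ {t} {w} 0<t level = record { positive = pos ; strict = str }
    where
    value : ∀ {c} → c ≢ top → count w c ≡ suc (toℕ c) ⊎ (t ≤ toℕ c × count w c ≡ 2 + toℕ c)
    value {c} c≢top with toℕ c <? t
    ... | yes c<t = inj₁ (level .low c<t)
    ... | no c≮t  = inj₂ (≮⇒≥ c≮t , level .high (≮⇒≥ c≮t) c≢top)

    upper : ∀ {c} → c ≢ top → count w c ≤ 2 + toℕ c
    upper c≢top with value c≢top
    ... | inj₁ eq       = ≤-trans (≤-reflexive eq) (n≤1+n _)
    ... | inj₂ (_ , eq) = ≤-reflexive eq

    pos : ∀ c → 0 < count w c
    pos c with c ≟ top
    ... | yes refl = ≤-trans (s≤s z≤n) (level .many)
    ... | no c≢top with value c≢top
    ...   | inj₁ eq       = subst (0 <_) (sym eq) z<s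
    ...   | inj₂ (_ , eq) = subst (0 <_) (sym eq) z<s

    str : ∀ {c d} → toℕ c < toℕ d → count w c < count w d
    str {c} {d} c<d with d ≟ top
    ... | yes refl = begin-strict
            count w c            ≤⟨ upper (<⇒≢top c<k) ⟩
            2 + toℕ c      ≤⟨ s≤s c<k ⟩
            1 + k          <⟨ s≤s (m<m+n k 0<t) ⟩
            suc (k + t)    ≤⟨ level .many ⟩
            count w top          ∎
      where
      open ≤-Reasoning
      c<k : toℕ c < k
      c<k = <-≤-trans c<d (toℕ≤pred[n] d)
    ... | no d≢top with value d≢top
    ...   | inj₁ eq = begin-strict
              count w c          ≡⟨ low-c ⟩
              suc (toℕ c)  <⟨ s≤s c<d ⟩
              suc (toℕ d)  ≡⟨ eq ⟨
              count w d          ∎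
      where
      open ≤-Reasoning
      low-c : count w c ≡ suc (toℕ c)
      -- The count of `d` is not raised, so `d`, and with it the smaller letter `c`, lies below `t`.
      low-c with toℕ d <? t
      ... | yes d<t = level .low (<-trans c<d d<t)
      ... | no d≮t  = contradiction (trans (sym eq) (level .high (≮⇒≥ d≮t) d≢top)) (1+n≢n ∘ sym)
    ...   | inj₂ (_ , eq) = begin-strict
              count w c          ≤⟨ upper (<⇒≢top (<-≤-trans c<d (toℕ≤pred[n] d))) ⟩
              2 + toℕ c    <⟨ s≤s (s≤s c<d) ⟩
              2 + toℕ d    ≡⟨ eq ⟨
              count w d          ∎
      where open ≤-Reasoning

  -- A top letter is spent on `b`, the largest letter that is not yet raised. The guaranteed number
  -- `k + t + 1` of top letters falls by one together with `t`.
  level-down : ∀ (w : Word) i {b} → lookup w i ≡ top → toℕ b < k →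
               Raised (suc (toℕ b)) w → Raised (toℕ b) (w [ i ]≔ b)
  level-down w i {b} wᵢ≡top b<k level = record
    { low  = λ c<b → trans (count-[]≔-other w i wᵢ≡top top≢b (<⇒≢top (<-trans c<b b<k)) (<⇒≢ c<b ∘ cong toℕ))
                           (level .low (m<n⇒m<1+n c<b))
    ; high = higher
    ; many = s≤s⁻¹ (subst₂ _≤_ (cong suc (+-suc k (toℕ b))) (sym (count-[]≔-old w i wᵢ≡top top≢b)) (level .many))
    }
    where
    top≢b : top ≢ b
    top≢b = <⇒≢top b<k ∘ sym

    higher : ∀ {c} → toℕ b ≤ toℕ c → c ≢ top → count (w [ i ]≔ b) c ≡ 2 + toℕ c
    higher {c} b≤c c≢top with c ≟ b
    ... | yes refl = trans (count-[]≔-new w i wᵢ≡top top≢b) (cong suc (level .low ≤-refl))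
    ... | no c≢b   = trans (count-[]≔-other w i wᵢ≡top top≢b c≢top c≢b)
                       (level .high (≤∧≢⇒< b≤c (c≢b ∘ sym ∘ toℕ-injective)) c≢top)

  -- Lowering the level to t = a makes room for the letter a to take one more unit
  -- from the top letter; then the two positions can be overwritten one at a time.
  swapWithTop : ∀ d (w : Word) p q {a} → 0 < toℕ a → suc (toℕ a) + d ≤ k →
                Raised (suc (toℕ a) + d) w → lookup w p ≡ a → lookup w q ≡ top →
                Linked F w (swap w p q)
  swapWithTop zero w p q {a} 0<a a≤k level w-p w-q =
    subst (Linked F w) (sym swap≡) (ltrans
      (linked-[]≔ w q a (level⇒∈ z<s level) u∈F)
      (linked-[]≔ (w [ q ]≔ a) p top u∈F
        (subst F swap≡ (increasing-resp-count (count-swap w p≢q) (level⇒∈ z<s level)))))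
    where
    a<k : toℕ a < k
    a<k = subst (_≤ k) (+-identityʳ _) a≤k

    p≢q : p ≢ q
    p≢q refl = <⇒≢top a<k (trans (sym w-p) w-q)

    -- This word has level `toℕ a`, which is positive because `a` is not the smallest letter.
    u∈F : w [ q ]≔ a ∈ F
    u∈F = level⇒∈ 0<a (level-down w q w-q a<k
            (subst (λ t → Raised t w) (+-identityʳ _) level))

    swap≡ : swap w p q ≡ (w [ q ]≔ a) [ p ]≔ top
    swap≡ = trans (cong₂ (λ x y → (w [ p ]≔ x) [ q ]≔ y) w-q w-p) ([]≔-commutes w p q p≢q)
  -- The letters above `a` are raised one by one from the largest, `b`: a top letter at a third
  -- position `r` becomes `b`, the exchange is done at the lower level, and `r` is restored.
  swapWithTop (suc d) w p q {a} 0<a b<k level w-p w-q = ltrans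
      (linked-[]≔ w r b w∈F w′∈F)
      (ltrans
        (subst (Linked F w′) (swap-[]≔ w p≢q b r≢p r≢q)
          (swapWithTop d w′ p q 0<a (<⇒≤ b<k′) level′
            (trans (lookup∘update′ (r≢p ∘ sym) w b) w-p) (trans (lookup∘update′ (r≢q ∘ sym) w b) w-q)))
        (lsym (linked-[]≔ (swap w p q) r b (increasing-resp-count (count-swap w p≢q) w∈F)
          (subst F (swap-[]≔ w p≢q b r≢p r≢q) (increasing-resp-count (count-swap w′ p≢q) w′∈F)))))
    where
    b<k′ : suc (toℕ a) + d < k
    b<k′ = subst (_≤ k) (+-suc (suc (toℕ a)) d) b<k

    b : Fin (suc k)
    b = fromℕ< (m<n⇒m<1+n b<k′)

    toℕ-b : toℕ b ≡ suc (toℕ a) + d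
    toℕ-b = toℕ-fromℕ< (m<n⇒m<1+n b<k′)

    b≢top : b ≢ top
    b≢top = <⇒≢top (subst (_< k) (sym toℕ-b) b<k′)

    w∈F : w ∈ F
    w∈F = level⇒∈ z<s level

    -- A second occurrence of the top letter is found after overwriting the one at q.
    another : ∃ λ r → lookup (w [ q ]≔ b) r ≡ top
    another = occurs (w [ q ]≔ b) (s≤s⁻¹ (subst (2 ≤_) (sym (count-[]≔-old w q w-q (b≢top ∘ sym)))
                (≤-trans (s≤s (≤-trans z<s (m≤n+m _ k))) (level .many))))

    r = proj₁ another

    r≢q : r ≢ q
    r≢q r≡q = b≢top (trans (sym (lookup∘update q w b))
                (subst (λ i → lookup (w [ q ]≔ b) i ≡ top) r≡q (proj₂ another)))

    w-r : lookup w r ≡ top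
    w-r = trans (sym (lookup∘update′ r≢q w b)) (proj₂ another)

    a≢top : a ≢ top
    a≢top = <⇒≢top (<-trans (s≤s (m≤m+n (toℕ a) d)) b<k′)

    p≢q : p ≢ q
    p≢q refl = a≢top (trans (sym w-p) w-q)

    r≢p : r ≢ p
    r≢p r≡p = a≢top (trans (sym w-p) (trans (cong (lookup w) (sym r≡p)) w-r))

    w′ = w [ r ]≔ b

    level′ : Raised (suc (toℕ a) + d) w′
    level′ = subst (λ t → Raised t w′) toℕ-b
      (level-down w r w-r (subst (_< k) (sym toℕ-b) b<k′)
        (subst (λ t → Raised t w) (trans (+-suc (suc (toℕ a)) d) (cong suc (sym toℕ-b))) level))

    w′∈F : w′ ∈ F
    w′∈F = level⇒∈ z<s level′

  -- Rearrangement by exchanges of letters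

  swapTop : ∀ (w : Word) p q → Raised k w → lookup w p ≢ zero → lookup w p ≢ top →
            lookup w q ≡ top → Linked F w (swap w p q)
  swapTop w p q level ≢zero ≢top w-q = swapWithTop (k ∸ suc (toℕ a)) w p q (n≢0⇒n>0 (≢zero ∘ toℕ-injective))
      (≤-reflexive split) (subst (λ t → Raised t w) (sym split) level) refl w-q
    where
    a = lookup w p
    split : suc (toℕ a) + (k ∸ suc (toℕ a)) ≡ k
    split = m+[n∸m]≡n (≢top⇒< ≢top)

  swap-comm : ∀ (w : Word) {p q} → p ≢ q → swap w p q ≡ swap w q p
  swap-comm w {p} {q} p≢q = []≔-commutes w p q p≢q

  -- If neither letter is `top`, a top letter at a third position `r` serves as intermediary: three
  -- exchanges, each involving `top`, compose to the exchange of `p` and `q` and return `top` to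
  -- `r`.
  swapLetters : ∀ (w : Word) p q → Raised k w → lookup w p ≢ zero → lookup w q ≢ zero →
                lookup w p ≢ lookup w q → Linked F w (swap w p q)
  swapLetters w p q level p≢zero q≢zero differ with lookup w p ≟ top | lookup w q ≟ top
  ... | _          | yes q≡top = swapTop w p q level p≢zero (differ ∘ λ p≡top → trans p≡top (sym q≡top)) q≡top
  ... | yes p≡top  | no q≢top  = subst (Linked F w) (swap-comm w {q} {p} (λ { refl → differ refl }))
                                   (swapTop w q p level q≢zero q≢top p≡top)
  ... | no p≢top   | no q≢top  = subst (Linked F w) (vec-ext pointwise)
      (ltrans (swapTop w p r level p≢zero p≢top r≡top)
      (ltrans (swapTop u₁ q p level₁ (q≢zero ∘ trans (sym u₁-q)) (q≢top ∘ trans (sym u₁-q)) u₁-p)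
              (swapTop u₂ r q level₂ (p≢zero ∘ trans (sym u₂-r)) (p≢top ∘ trans (sym u₂-r)) u₂-q)))
    where
    found : ∃ λ r → lookup w r ≡ top
    found = occurs w (≤-trans (s≤s z≤n) (level .many))

    r = proj₁ found
    r≡top = proj₂ found

    p≢q : p ≢ q
    p≢q = differ ∘ cong (lookup w)

    p≢r : p ≢ r
    p≢r p≡r = p≢top (trans (cong (lookup w) p≡r) r≡top)

    q≢r : q ≢ r
    q≢r q≡r = q≢top (trans (cong (lookup w) q≡r) r≡top)

    u₁ u₂ u₃ : Word
    u₁ = swap w p r
    u₂ = swap u₁ q p
    u₃ = swap u₂ r q

    level₁ : Raised k u₁
    level₁ = raised-resp-count (count-swap w p≢r) level

    level₂ : Raised k u₂
    level₂ = raised-resp-count (count-swap u₁ (p≢q ∘ sym)) level₁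

    u₁-p : lookup u₁ p ≡ top
    u₁-p = trans (lookup-swap-left w p≢r) r≡top

    u₁-q : lookup u₁ q ≡ lookup w q
    u₁-q = lookup-swap-other w p≢r (p≢q ∘ sym) q≢r

    u₂-q : lookup u₂ q ≡ top
    u₂-q = trans (lookup-swap-left u₁ (p≢q ∘ sym)) u₁-p

    u₂-r : lookup u₂ r ≡ lookup w p
    u₂-r = trans (lookup-swap-other u₁ (p≢q ∘ sym) (q≢r ∘ sym) (p≢r ∘ sym)) (lookup-swap-right w p≢r)

    pointwise : ∀ i → lookup u₃ i ≡ lookup (swap w p q) i
    pointwise i with i ≟ p | i ≟ q | i ≟ r
    ... | yes refl | _ | _ = begin
          lookup u₃ p            ≡⟨ lookup-swap-other u₂ (q≢r ∘ sym) p≢r p≢q ⟩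
          lookup u₂ p            ≡⟨ lookup-swap-right u₁ (p≢q ∘ sym) ⟩
          lookup u₁ q            ≡⟨ u₁-q ⟩
          lookup w q             ≡⟨ lookup-swap-left w p≢q ⟨
          lookup (swap w p q) p  ∎
      where open ≡-Reasoning
    ... | no _ | yes refl | _ = begin
          lookup u₃ q            ≡⟨ lookup-swap-right u₂ (q≢r ∘ sym) ⟩
          lookup u₂ r            ≡⟨ u₂-r ⟩
          lookup w p             ≡⟨ lookup-swap-right w p≢q ⟨
          lookup (swap w p q) q  ∎
      where open ≡-Reasoning
    ... | no _ | no _ | yes refl = begin
          lookup u₃ r            ≡⟨ lookup-swap-left u₂ (q≢r ∘ sym) ⟩
          lookup u₂ q            ≡⟨ u₂-q ⟩
          top                    ≡⟨ r≡top ⟨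
          lookup w r             ≡⟨ lookup-swap-other w p≢q (p≢r ∘ sym) (q≢r ∘ sym) ⟨
          lookup (swap w p q) r  ∎
      where open ≡-Reasoning
    ... | no i≢p | no i≢q | no i≢r = begin
          lookup u₃ i            ≡⟨ lookup-swap-other u₂ (q≢r ∘ sym) i≢r i≢q ⟩
          lookup u₂ i            ≡⟨ lookup-swap-other u₁ (p≢q ∘ sym) i≢q i≢p ⟩
          lookup u₁ i            ≡⟨ lookup-swap-other w p≢r i≢p i≢r ⟩
          lookup w i             ≡⟨ lookup-swap-other w p≢q i≢p i≢q ⟨
          lookup (swap w p q) i  ∎
      where open ≡-Reasoning

  -- Overwriting a second zero by `top` would bring the count of `zero` down to 0 although the first
  -- position still holds one.
  soleZero : 0 < k → ∀ (w : Word) → count w zero ≡ 1 → lookup w zero ≡ zero →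
             ∀ {i} → i ≢ zero → lookup w i ≢ zero
  soleZero 0<k w once w-0 {i} i≢0 w-i = <⇒≢ (subst (λ c → 0 < count u c) u-0 (count-positive u zero))
      (sym (suc-injective (trans (count-[]≔-old w i w-i (<⇒≢top 0<k)) once)))
    where
    u = w [ i ]≔ top
    u-0 : lookup u zero ≡ zero
    u-0 = trans (lookup∘update′ (i≢0 ∘ sym) w top) w-0

  -- The positions are corrected from left to right: `m` of them agree already and `fuel` remain.
  -- The letter required next is fetched from a position where `w` and `v` differ, hence not from
  -- the finished part. The single zero stays in front, out of the exchanges.
  arrange : 0 < k → ∀ {v : Word} → Raised k v → lookup v zero ≡ zero →
            ∀ fuel m w → m + fuel ≡ suc n → (∀ c → count w c ≡ count v c) →
            lookup w zero ≡ zero → (∀ j → toℕ j < m → lookup w j ≡ lookup v j) → Linked F w v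
  arrange 0<k {v} level v-0 zero m w eq counts w-0 agree =
    subst (Linked F w) (vec-ext λ j → agree j (subst (toℕ j <_) (trans (sym eq) (+-identityʳ m)) (toℕ<n j))) lrefl
  arrange 0<k {v} level v-0 (suc fuel) m w eq counts w-0 agree = step
    where
    m<1+n : m < suc n
    m<1+n = subst (m <_) eq (m<m+n m z<s)

    i = fromℕ< m<1+n

    toℕ-i : toℕ i ≡ m
    toℕ-i = toℕ-fromℕ< m<1+n

    eq′ : suc m + fuel ≡ suc n
    eq′ = trans (sym (+-suc m fuel)) eq

    extend : ∀ (u : Word) → (∀ j → toℕ j < m → lookup u j ≡ lookup v j) →
             lookup u i ≡ lookup v i → ∀ j → toℕ j < suc m → lookup u j ≡ lookup v j
    extend u agree u-i j j<1+m with m<1+n⇒m<n∨m≡n j<1+m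
    ... | inj₁ j<m = agree j j<m
    ... | inj₂ j≡m rewrite toℕ-injective {i = j} {i} (trans j≡m (sym toℕ-i)) = u-i

    once-v : count v zero ≡ 1
    once-v = level .low 0<k

    step : Linked F w v
    step with lookup w i ≟ lookup v i
    ... | yes w-i = arrange 0<k level v-0 fuel (suc m) w eq′ counts w-0 (extend w agree w-i)
    ... | no w-i≢ with surplus w v {i} (counts (lookup v i)) refl w-i≢
    ...   | q , w-q , v-q≢ = ltrans
            (swapLetters w i q (raised-resp-count counts level)
              (soleZero 0<k w (trans (counts zero) once-v) w-0 i≢0)
              (v-i≢zero ∘ trans (sym w-q))
              (λ same → w-i≢ (trans same w-q)))
            (arrange 0<k level v-0 fuel (suc m) (swap w i q) eq′
              (λ c → trans (count-swap w i≢q c) (counts c))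
              (trans (lookup-swap-other w i≢q (i≢0 ∘ sym) 0≢q) w-0)
              (extend (swap w i q) (λ j j<m → trans (lookup-swap-other w i≢q (j≢i j<m) (j≢q j<m)) (agree j j<m))
                      (trans (lookup-swap-left w i≢q) w-q)))
      where
      i≢0 : i ≢ zero
      i≢0 i≡0 = w-i≢ (subst (λ i → lookup w i ≡ lookup v i) (sym i≡0) (trans w-0 (sym v-0)))

      v-i≢zero : lookup v i ≢ zero
      v-i≢zero = soleZero 0<k v once-v v-0 i≢0

      i≢q : i ≢ q
      i≢q i≡q = w-i≢ (trans (cong (lookup w) i≡q) w-q)

      0≢q : zero ≢ q
      0≢q 0≡q = v-i≢zero (trans (sym w-q) (trans (cong (lookup w) (sym 0≡q)) w-0))

      j≢i : ∀ {j} → toℕ j < m → j ≢ i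
      j≢i j<m refl = <-irrefl toℕ-i j<m

      j≢q : ∀ {j} → toℕ j < m → j ≢ q
      j≢q j<m refl = v-q≢ (trans (sym (agree _ j<m)) w-q)

  zeroFirst : ∀ {w} → w ∈ F → ∃ λ u → Linked F w u × lookup u zero ≡ zero × (∀ c → count u c ≡ count w c)
  zeroFirst {w} w∈F with occurs w (w∈F .positive zero)
  ... | i , w-i = go (toℕ i) w∈F refl w-i
    where
    go : ∀ m {w : Word} {i} → w ∈ F → toℕ i ≡ m → lookup w i ≡ zero →
         ∃ λ u → Linked F w u × lookup u zero ≡ zero × (∀ c → count u c ≡ count w c)
    go zero    {w} {zero}  w∈F _  w-i = w , lrefl , w-i , λ _ → refl
    go (suc m) {w} {suc i} w∈F eq w-i
      with u , l , u-0 , counts ← go m {rotate w} {inject₁ i} (F-rotate w∈F)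
             (trans (toℕ-inject₁ i) (suc-injective eq)) (trans (lookup-rotate w i) w-i) =
      u , ltrans (rotation w∈F) l , u-0 , λ c → trans (counts c) (count-rotate w c)

  -- Connectivity and inhabitation under the length bound

  module _ (bound : suc (k + k) + triangle k ≤ suc n) where

    bottom-top : ∀ {w : Word} → Bottom w → triangle k + count w top ≡ suc n
    bottom-top {w} bottom = begin
      triangle k + count w top                           ≡⟨ cong (_+ count w top) (sum-cong-≗ lower) ⟨
      sum (λ i → count w (inject₁ i)) + count w top      ≡⟨ sum-init-last (count w) ⟨
      sum (count w)                                      ≡⟨ sum-count w ⟩
      suc n                                              ∎
      where
      open ≡-Reasoning
      lower : ∀ i → count w (inject₁ i) ≡ suc (toℕ i)
      lower i = trans (bottom (inject₁ i) (<⇒≢top (subst (_< k) (sym (toℕ-inject₁ i)) (toℕ<n i))))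
                      (cong suc (toℕ-inject₁ i))

    -- At level `k` no letter is raised. Once `triangle k` positions are taken off, the length bound
    -- leaves at least `2k + 1` top letters, one for each of up to `k` raises and enough to stay
    -- ahead.
    bottom⇒level : ∀ {w : Word} → Bottom w → Raised k w
    bottom⇒level {w} bottom = record
      { low  = λ c<k → bottom _ (<⇒≢top c<k)
      ; high = λ k≤c c≢top → contradiction (≢top⇒< c≢top) (≤⇒≯ k≤c)
      ; many = +-cancelˡ-≤ (triangle k) _ _
                 (subst₂ _≤_ (+-comm _ (triangle k)) (sym (bottom-top {w} bottom)) bound)
      }

    bottom-unique : ∀ {u v : Word} → Bottom u → Bottom v → ∀ c → count u c ≡ count v c
    bottom-unique {u} {v} bottom-u bottom-v c with c ≟ top
    ... | yes refl = +-cancelˡ-≡ (triangle k) _ _ (trans (bottom-top {u} bottom-u) (sym (bottom-top {v} bottom-v)))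
    ... | no c≢top = trans (bottom-u c c≢top) (sym (bottom-v c c≢top))

    normalise : ∀ {w} → w ∈ F → ∃ λ u → Linked F w u × lookup u zero ≡ zero × Bottom u
    normalise w∈F with toBottom w∈F
    ... | u , u∈F , l , bottom with zeroFirst u∈F
    ...   | v , l′ , v-0 , counts = v , ltrans l l′ , v-0 , λ c c≢top → trans (counts c) (bottom c c≢top)

    -- Both words lead to words with the same counts and a leading zero, and these are
    -- rearrangements of each other.
    connected : 0 < k → ∀ {u v} → u ∈ F → v ∈ F → Linked F u v
    connected 0<k u∈F v∈F with normalise u∈F | normalise v∈F
    ... | u , lu , u-0 , bottom-u | v , lv , v-0 , bottom-v =
      ltrans lu (ltrans
        (arrange 0<k (bottom⇒level {v} bottom-v) v-0 (suc n) 0 u refl (bottom-unique {u} {v} bottom-u bottom-v) u-0 (λ _ ()))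
        (lsym lv))

    -- The length suffices for counts 1, ..., `suc k`; the `rest` of the positions is filled with
    -- `top`, which keeps the counts increasing.
    member : ∃ λ w → w ∈ F
    member = subst (λ m → ∃ λ (w : String (suc k) m) → Increasing w)
               (m∸n+n≡m total) (replicate rest top ++ v , increasing)
      where
      total : triangle (suc k) ≤ suc n
      total = begin
        triangle (suc k)            ≡⟨ triangle-suc k ⟩
        triangle k + suc k          ≤⟨ +-monoʳ-≤ (triangle k) (s≤s (m≤m+n k k)) ⟩
        triangle k + suc (k + k)    ≡⟨ +-comm (triangle k) _ ⟩
        suc (k + k) + triangle k    ≤⟨ bound ⟩
        suc n                       ∎
        where open ≤-Reasoning

      rest = suc n ∸ triangle (suc k)

      realized = realize {suc k} (λ c → suc (toℕ c))
      v = proj₁ realized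

      value : ∀ c → count (replicate rest top ++ v) c ≡ rest * δ top c + suc (toℕ c)
      value c = trans (count-replicate-++ rest top v c) (cong (rest * δ top c +_) (proj₂ realized c))

      increasing : Increasing (replicate rest top ++ v)
      increasing .positive c = subst (0 <_) (sym (value c)) (m≤n⇒m≤o+n (rest * δ top c) z<s)
      increasing .strict {c} {d} c<d
        rewrite value c | value d
              | δ-≢ {x = top} {c} (<⇒≢top (<-≤-trans c<d (toℕ≤pred[n] d)) ∘ sym) | *-zeroʳ rest =
        m≤n⇒m≤o+n (rest * δ top d) (s≤s c<d)

theorem1 : (k n : ℕ) .{{_ : NonZero k}} .{{_ : NonZero n}} →
    n ≥ ((k + 4) * (k ∸ 1)) / 2 + 1 →
    Ucycle (OntoIncreasingStrings k n)
theorem1 (suc k) (suc n) n≥ = Ucycle-resp-⇔ increasing⇒onto onto⇒increasing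
    (ucycle w₀ w₀∈F (linked k bound w₀∈F))
  where
  bound : suc (k + k) + triangle k ≤ suc n
  bound = subst (_≤ suc n) (bound≡triangle k) n≥

  open Connectivity k n using (F; F-rotate; member)
  open Eulerian F increasing? F-rotate using (ucycle)

  w₀ = proj₁ (member bound)
  w₀∈F = proj₂ (member bound)

  linked : ∀ k → suc (k + k) + triangle k ≤ suc n → ∀ {u v : String (suc k) (suc n)} →
           Increasing u → Increasing v → Linked Increasing u v
  -- Over a one-letter alphabet there is only one word of the given length; larger alphabets satisfy
  -- `0 < k` as `connected` demands.
  linked zero    _     {u} {v} _ _ =
    subst (Linked Increasing u) (vec-ext λ i → sole (lookup u i) (lookup v i)) lrefl
    where
    sole : (c d : Fin 1) → c ≡ d
    sole zero zero = refl
  linked (suc k) bound = Connectivity.connected (suc k) n bound z<s
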